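{- For every positive integer $n$, the number of pseudo-symmetric gapsets in $\mathcal{G}_{2n+1}(3n+2)$ is $2^{n-1}$.
   Context: A gapset is a finite set $G\subset\mathbb{N}=\{1,2,\dots\}$ such that whenever $z\in G$ and $z=x+y$ with $x,y\in\mathbb{N}$, then $x\in G$ or $y\in G$; its genus is $g=\#G$. Writing $G=\{\ell_1<\dots<\ell_g\}$, the Frobenius number is $F(G)=\ell_g$; $G$ is pseudo-symmetric if $F(G)=2g-2$. $G$ is pure $\kappa$-sparse if $\ell_{i+1}-\ell_i\le\kappa$ for all $i$ with equality for some $i$; $\mathcal{G}_\kappa(g)$ is the set of pure $\kappa$-sparse gapsets of genus $g$. -}

module Defs where

open import Level using (Level; _⊔_)
open import Data.Nat using (ℕ; _+_; _*_; _∸_; _≤_; _<_)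
open import Data.List using (List; length; last; zipWith; drop)
open import Data.List.Membership.Propositional using (_∈_)
open import Data.List.Relation.Unary.All using (All)
open import Data.List.Relation.Unary.Linked using (Linked)
open import Data.List.Relation.Unary.Unique.Propositional using (Unique)
open import Data.Maybe using (just)
open import Data.Product using (_×_; ∃-syntax)
open import Data.Sum using (_⊎_)
open import Function.Bundles using (_⇔_)
open import Relation.Binary.PropositionalEquality using (_≡_)

-- A finite set of positive integers {ℓ₁ < ⋯ < ℓ_g} is represented by its
-- strictly increasing enumeration, so that equal sets are equal lists.
record IsFiniteSet⁺ (G : List ℕ) : Set where
  field
    positive   : All (1 ≤_) G
    increasing : Linked _<_ G

record IsGapset (G : List ℕ) : Set where
  field
    isFiniteSet⁺ : IsFiniteSet⁺ G
    split        : ∀ {z} x y → 1 ≤ x → 1 ≤ y → z ∈ G → z ≡ x + y →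
                   x ∈ G ⊎ y ∈ G

genus : List ℕ → ℕ
genus = length

-- The Frobenius number is the last entry; the empty set has none.
IsFrobenius : List ℕ → ℕ → Set
IsFrobenius G F = last G ≡ just F

-- F(G) = 2g − 2, written without truncated subtraction.
PseudoSymmetric : List ℕ → Set
PseudoSymmetric G = ∃[ F ] (IsFrobenius G F × F + 2 ≡ 2 * genus G)

-- The list of ℓᵢ₊₁ − ℓᵢ for 1 ≤ i < g; on increasing lists the
-- subtraction never truncates.
differences : List ℕ → List ℕ
differences G = zipWith (λ ℓ ℓ′ → ℓ′ ∸ ℓ) G (drop 1 G)

PureSparse : ℕ → List ℕ → Set
PureSparse κ G = All (_≤ κ) (differences G) × κ ∈ differences G

record 𝒢 (κ g : ℕ) (G : List ℕ) : Set where
  field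
    isGapset   : IsGapset G
    pureSparse : PureSparse κ G
    hasGenus   : genus G ≡ g

-- Exactly N elements of A satisfy P (up to propositional equality).
HasCount : ∀ {a p : Level} {A : Set a} → (A → Set p) → ℕ → Set (a ⊔ p)
HasCount {A = A} P N =
  ∃[ xs ] (Unique {A = A} xs × (∀ x → x ∈ xs ⇔ P x) × length xs ≡ N)

{-# OPTIONS --safe #-}
-- The jump of length κ = a + 1, say from ℓ to ℓ′, forces 1, …, a into G: if some
-- i ≤ a were missing, then ℓ′ − i would be a gap inside the jump.  For each x the
-- gapset meets {x , F − x}, and since F = 2g − 2 there are just enough elements
-- to choose one of each pair, so G consists of 1, …, a, of F, and of a choice
-- from each pair {x , F − x} with a < x.  The gap preceding F is at least F − κ,
-- which decides the pair {κ , F − κ}.  Conversely every choice for the remaining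
-- pairs gives a gapset, as a sum of two elements larger than a that lies in G is F.
module Submission where

open import Defs
open import Data.Bool using (Bool; true; false)
open import Data.List using (List; []; _∷_; _++_; _∷ʳ_; length; map; last; head; applyUpTo)
open import Data.List.Membership.Propositional using (_∈_)
open import Data.List.Membership.Propositional.Properties
  using (∈-++⁺ˡ; ∈-++⁺ʳ; ∈-++⁻; ∈-map⁺; ∈-map⁻; ∈-applyUpTo⁺; ∈-applyUpTo⁻)
open import Data.List.Properties
  using (length-++; length-map; length-applyUpTo; ++-assoc; ++-cancelˡ; ∷ʳ-injectiveˡ;
         ∷-injectiveʳ; applyUpTo-∷ʳ)
open import Data.List.Relation.Binary.Subset.Propositional using (_⊆_)
open import Data.List.Relation.Unary.All as All using (All; []; _∷_)
import Data.List.Relation.Unary.All.Properties as All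
open import Data.List.Relation.Unary.AllPairs as AllPairs using (AllPairs; []; _∷_)
import Data.List.Relation.Unary.AllPairs.Properties as AllPairs
open import Data.List.Relation.Unary.Any using (here; there)
open import Data.List.Relation.Unary.Linked as Linked using (Linked; []; [-]; _∷_)
import Data.List.Relation.Unary.Linked.Properties as Linked
open import Data.List.Relation.Unary.Unique.Propositional using (Unique)
import Data.List.Relation.Unary.Unique.Propositional.Properties as Unique
open import Data.Maybe using (just)
open import Data.Maybe.Relation.Binary.Connected using (Connected; just)
open import Data.Nat
  using (ℕ; zero; suc; _+_; _*_; _∸_; _^_; _≤_; _<_; z≤n; s≤s; s≤s⁻¹; z<s; NonZero; _≤?_)
open import Data.Nat.Properties
open import Data.List.Membership.DecPropositional _≟_ using (_∈?_)
open import Data.Nat.Tactic.RingSolver using (solve-∀)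
open import Data.Product using (_×_; _,_; proj₁; proj₂; ∃-syntax; ∃₂)
open import Data.Sum as Sum using (_⊎_; inj₁; inj₂)
open import Data.Vec as Vec using (Vec; []; _∷_)
open import Function using (_∘_)
open import Function.Bundles using (mk⇔)
open import Relation.Binary.PropositionalEquality
open import Relation.Nullary using (yes; no; contradiction)

-- Strictly increasing lists and their differences.

Ascending : List ℕ → Set
Ascending = AllPairs _<_

-- Induction on both lists. If the heads differ, `x` lies in the tail `ys`, hence above `y`, and so
-- does everything in `x ∷ xs`. The whole of `x ∷ xs` is then contained in `ys`, so equal to it by
-- induction, although it is too long for that.
⊆∧length-≥⇒≡ : ∀ {xs ys} → Ascending xs → Ascending ys → xs ⊆ ys →
               length ys ≤ length xs → xs ≡ ys
⊆∧length-≥⇒≡ {[]}     {[]}     _ _ _ _ = refl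
⊆∧length-≥⇒≡ {x ∷ xs} {[]}     _ _ s _ with () ← s (here refl)
⊆∧length-≥⇒≡ {x ∷ xs} {y ∷ ys} (x< ∷ xs↗) (y< ∷ ys↗) s le with s (here refl)
... | here refl = cong (x ∷_) (⊆∧length-≥⇒≡ xs↗ ys↗ s′ (s≤s⁻¹ le))
  where
  s′ : xs ⊆ ys
  s′ z∈xs with s (there z∈xs)
  ... | here refl = contradiction (All.lookup x< z∈xs) (<-irrefl refl)
  ... | there z∈ys = z∈ys
... | there x∈ys = contradiction (subst (λ l → suc (length ys) ≤ length l) x∷xs≡ys le) 1+n≰n
  where
  y<z : ∀ {z} → z ∈ x ∷ xs → y < z
  y<z (here refl)  = All.lookup y< x∈ys
  y<z (there z∈xs) = <-trans (All.lookup y< x∈ys) (All.lookup x< z∈xs)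
  s′ : x ∷ xs ⊆ ys
  s′ z∈ with s z∈
  ... | here refl  = contradiction (y<z z∈) (<-irrefl refl)
  ... | there z∈ys = z∈ys
  x∷xs≡ys : x ∷ xs ≡ ys
  x∷xs≡ys = ⊆∧length-≥⇒≡ (x< ∷ xs↗) ys↗ s′ (≤-trans (n≤1+n _) le)

last-∷ʳ : ∀ {A : Set} (xs : List A) {x} → last (xs ∷ʳ x) ≡ just x
last-∷ʳ []           = refl
last-∷ʳ (_ ∷ [])     = refl
last-∷ʳ (_ ∷ y ∷ xs) = last-∷ʳ (y ∷ xs)

last-∈ : ∀ {A : Set} (xs : List A) {x} → last xs ≡ just x → x ∈ xs
last-∈ (x ∷ [])     refl = here refl
last-∈ (_ ∷ y ∷ xs) eq   = there (last-∈ (y ∷ xs) eq)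

length-∷ʳ : ∀ {A : Set} (xs : List A) {x} → length (xs ∷ʳ x) ≡ suc (length xs)
length-∷ʳ xs = trans (length-++ xs) (+-comm (length xs) 1)

Linked⇒differences-≤ : ∀ {κ xs} → Linked (λ x y → y ≤ x + κ) xs → All (_≤ κ) (differences xs)
Linked⇒differences-≤ []                     = []
Linked⇒differences-≤ [-]                    = []
Linked⇒differences-≤ (_∷_ {x = x} {y} p ps) = m≤n+o⇒m∸n≤o y x p ∷ Linked⇒differences-≤ ps

∈-differences⁺ : ∀ xs {a b ys} → b ∸ a ∈ differences (xs ++ a ∷ b ∷ ys)
∈-differences⁺ []           = here refl
∈-differences⁺ (_ ∷ [])     = there (here refl)
∈-differences⁺ (_ ∷ x ∷ xs) = there (∈-differences⁺ (x ∷ xs))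

-- The last component expresses that `a` and `b` are neighbours: nothing in `xs` lies strictly
-- between them.
∈-differences⁻ : ∀ {d xs} → Ascending xs → d ∈ differences xs →
                 ∃₂ λ a b → b ∈ xs × a ∈ xs × d ≡ b ∸ a × (∀ {c} → c ∈ xs → c ≤ a ⊎ b ≤ c)
∈-differences⁻ {xs = x ∷ y ∷ zs} (x< ∷ y< ∷ _) (here refl) =
  x , y , there (here refl) , here refl , refl , λ where
    (here refl)          → inj₁ ≤-refl
    (there (here refl))  → inj₂ ≤-refl
    (there (there c∈zs)) → inj₂ (<⇒≤ (All.lookup y< c∈zs))
∈-differences⁻ {xs = x ∷ y ∷ zs} (x< ∷ xs↗) (there d∈)
  with a , b , b∈ , a∈ , eq , consecutive ← ∈-differences⁻ xs↗ d∈ =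
  a , b , there b∈ , there a∈ , eq , λ where
    (here refl) → inj₁ (<⇒≤ (All.lookup x< a∈))
    (there c∈)  → consecutive c∈

-- Serves to show that `F − κ` cannot exceed every element below `F`.
penultimate : ∀ {κ F xs} → Ascending xs → All (_≤ κ) (differences xs) → last xs ≡ just F →
              2 ≤ length xs → ∃[ p ] (p ∈ xs × p < F × F ≤ p + κ)
penultimate {xs = x ∷ []} _ _ _ (s≤s ())
penultimate {xs = x ∷ y ∷ []} ((x<y ∷ _) ∷ _) (d ∷ _) refl _ =
  x , here refl , x<y , ≤-trans (m≤n+m∸n y x) (+-monoʳ-≤ x d)
penultimate {xs = x ∷ y ∷ z ∷ zs} (_ ∷ xs↗) (_ ∷ ds) eq _
  with p , p∈ , p< , le ← penultimate xs↗ ds eq (s≤s (s≤s z≤n)) = p , there p∈ , p< , le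

-- Choosing one number from each pair with a fixed sum.

-- One element of each pair {x , y} of numbers ≥ lo with x + y = 2 (lo + k): `true` selects
-- the smaller one.
transversal : ∀ {k} → ℕ → Vec Bool k → List ℕ
transversal         lo []          = lo ∷ []
transversal         lo (true  ∷ v) = lo ∷ transversal (suc lo) v
transversal {suc k} lo (false ∷ v) = transversal (suc lo) v ∷ʳ (lo + 2 * suc k)

upper-suc : ∀ lo k → suc (suc lo + 2 * k) ≡ lo + 2 * suc k
upper-suc = solve-∀

lower+upper : ∀ lo k → lo + (lo + 2 * k) ≡ 2 * (lo + k)
lower+upper = solve-∀

partner : ∀ lo {y} k → lo + y ≡ 2 * (lo + k) → y ≡ lo + 2 * k
partner lo k eq = +-cancelˡ-≡ lo _ _ (trans eq (sym (lower+upper lo k)))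

transversal-bounds : ∀ {k} lo (v : Vec Bool k) →
                     All (λ x → lo ≤ x × x ≤ lo + 2 * k) (transversal lo v)
transversal-bounds lo [] = (≤-refl , m≤m+n lo 0) ∷ []
transversal-bounds {suc k} lo (b ∷ v) = go b
  where
  inner : All (λ x → lo ≤ x × x ≤ lo + 2 * suc k) (transversal (suc lo) v)
  inner = All.map
    (λ (l , u) → <⇒≤ l , ≤-trans u (≤-trans (n≤1+n _) (≤-reflexive (upper-suc lo k))))
    (transversal-bounds (suc lo) v)
  go : ∀ b → All (λ x → lo ≤ x × x ≤ lo + 2 * suc k) (transversal lo (b ∷ v))
  go true  = (≤-refl , m≤m+n lo _) ∷ inner
  go false = All.∷ʳ⁺ inner (m≤m+n lo _ , ≤-refl)

ascending-∷ʳ : ∀ {xs x} → Ascending xs → All (_< x) xs → Ascending (xs ∷ʳ x)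
ascending-∷ʳ xs↗ <x = AllPairs.++⁺ xs↗ ([] ∷ []) (All.map (_∷ []) <x)

transversal-ascending : ∀ {k} lo (v : Vec Bool k) → Ascending (transversal lo v)
transversal-ascending lo []         = [] ∷ []
transversal-ascending lo (true ∷ v) =
  All.map proj₁ (transversal-bounds (suc lo) v) ∷ transversal-ascending (suc lo) v
transversal-ascending {suc k} lo (false ∷ v) =
  ascending-∷ʳ (transversal-ascending (suc lo) v)
    (All.map (λ (_ , u) → ≤-trans (s≤s u) (≤-reflexive (upper-suc lo k)))
      (transversal-bounds (suc lo) v))

-- Each of the `k` Booleans contributes one number; the extra one is the midpoint `lo + k`, which is
-- its own partner.
length-transversal : ∀ {k} lo (v : Vec Bool k) → length (transversal lo v) ≡ suc k
length-transversal lo []          = refl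
length-transversal lo (true  ∷ v) = cong suc (length-transversal (suc lo) v)
length-transversal lo (false ∷ v) =
  trans (length-∷ʳ (transversal (suc lo) v)) (cong suc (length-transversal (suc lo) v))

-- All entries on the right exceed `lo`, so the heads differ.
lower∷-≢-∷ʳupper : ∀ {k lo} (v : Vec Bool k) {xs} →
                   lo ∷ xs ≢ transversal (suc lo) v ∷ʳ (lo + 2 * suc k)
lower∷-≢-∷ʳupper {k} {lo} v eq
  with All.∷ʳ⁺ (All.map proj₁ (transversal-bounds (suc lo) v))
               (≤-trans (m≤m+n (suc lo) _) (≤-trans (n≤1+n _) (≤-reflexive (upper-suc lo k))))
... | all rewrite sym eq with lo<lo ∷ _ ← all = 1+n≰n lo<lo

transversal-injective : ∀ {k} lo {v w : Vec Bool k} → transversal lo v ≡ transversal lo w → v ≡ w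
transversal-injective lo {[]}        {[]}        _  = refl
transversal-injective lo {true ∷ v}  {true ∷ w}  eq =
  cong (true ∷_) (transversal-injective (suc lo) (∷-injectiveʳ eq))
transversal-injective lo {true ∷ v}  {false ∷ w} eq = contradiction eq (lower∷-≢-∷ʳupper w)
transversal-injective lo {false ∷ v} {true ∷ w}  eq = contradiction (sym eq) (lower∷-≢-∷ʳupper v)
transversal-injective lo {false ∷ v} {false ∷ w} eq =
  cong (false ∷_) (transversal-injective (suc lo) (∷ʳ-injectiveˡ _ _ eq))

-- If neither number is `lo`, both are at least `suc lo`, and the inner transversal has the same
-- pair sum, since `lo` grows by one as `k` drops by one. Otherwise the pair is the outermost one,
-- decided by the first Boolean.
transversal-meets : ∀ {k x y} lo (v : Vec Bool k) → lo ≤ x → lo ≤ y → x + y ≡ 2 * (lo + k) →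
                    x ∈ transversal lo v ⊎ y ∈ transversal lo v
transversal-meets {zero} {x} {y} lo [] lo≤x lo≤y eq = inj₁ (here (≤-antisym x≤lo lo≤x))
  where
  x≤lo : x ≤ lo
  x≤lo = +-cancelʳ-≤ lo x lo (≤-trans (+-monoʳ-≤ x lo≤y) (≤-reflexive (trans eq (double lo))))
    where
    double : ∀ lo → 2 * (lo + 0) ≡ lo + lo
    double = solve-∀
transversal-meets {suc k} {x} {y} lo (b ∷ v) lo≤x lo≤y eq
  with m≤n⇒m<n∨m≡n lo≤x | m≤n⇒m<n∨m≡n lo≤y | b
... | inj₂ refl | _         | true  = inj₁ (here refl)
... | _         | inj₂ refl | true  = inj₂ (here refl)
... | inj₂ refl | _         | false = inj₂ (∈-++⁺ʳ _ (here (partner lo (suc k) eq)))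
... | _         | inj₂ refl | false =
  inj₁ (∈-++⁺ʳ _ (here (partner lo (suc k) (trans (+-comm lo x) eq))))
... | inj₁ lo<x | inj₁ lo<y | b
  with transversal-meets (suc lo) v lo<x lo<y (trans eq (cong (2 *_) (+-suc lo k))) | b
... | m | true  = Sum.map there there m
... | m | false = Sum.map ∈-++⁺ˡ ∈-++⁺ˡ m

-- With `P` membership in a gapset containing `2 * (lo + k)`, the hypothesis is the gapset condition
-- for the decompositions of that number.
∃transversal : ∀ {P : ℕ → Set} lo k →
               (∀ x y → lo ≤ x → lo ≤ y → x + y ≡ 2 * (lo + k) → P x ⊎ P y) →
               ∃[ v ] All P (transversal {k} lo v)
∃transversal lo zero meets
  -- The midpoint is paired with itself, so both alternatives give `P lo`.
  with meets lo lo ≤-refl ≤-refl (trans (cong (lo +_) (sym (+-identityʳ lo))) (lower+upper lo 0))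
... | inj₁ p = [] , p ∷ []
... | inj₂ p = [] , p ∷ []
∃transversal lo (suc k) meets
  with v , inner ← ∃transversal (suc lo) k
         (λ x y lo<x lo<y eq →
           meets x y (<⇒≤ lo<x) (<⇒≤ lo<y) (trans eq (cong (2 *_) (sym (+-suc lo k)))))
  with meets lo (lo + 2 * suc k) ≤-refl (m≤m+n lo _) (lower+upper lo (suc k))
... | inj₁ p = true  ∷ v , p ∷ inner
... | inj₂ p = false ∷ v , All.∷ʳ⁺ inner p

-- Enumeration of Boolean vectors.

binaryVectors : ∀ k → List (Vec Bool k)
binaryVectors zero    = [] ∷ []
binaryVectors (suc k) = map (true ∷_) (binaryVectors k) ++ map (false ∷_) (binaryVectors k)

∈-binaryVectors : ∀ {k} (v : Vec Bool k) → v ∈ binaryVectors k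
∈-binaryVectors []          = here refl
∈-binaryVectors (true  ∷ v) = ∈-++⁺ˡ (∈-map⁺ _ (∈-binaryVectors v))
∈-binaryVectors (false ∷ v) = ∈-++⁺ʳ _ (∈-map⁺ _ (∈-binaryVectors v))

binaryVectors-unique : ∀ k → Unique (binaryVectors k)
binaryVectors-unique zero    = [] ∷ []
binaryVectors-unique (suc k) =
  Unique.++⁺ (Unique.map⁺ (λ { refl → refl }) (binaryVectors-unique k))
             (Unique.map⁺ (λ { refl → refl }) (binaryVectors-unique k))
             disjoint
  where
  disjoint : ∀ {v} → v ∈ map (true ∷_) (binaryVectors k) × v ∈ map (false ∷_) (binaryVectors k) → _
  disjoint (p , q) with _ , _ , refl ← ∈-map⁻ _ p with _ , _ , () ← ∈-map⁻ _ q

length-binaryVectors : ∀ k → length (binaryVectors k) ≡ 2 ^ k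
length-binaryVectors zero    = refl
length-binaryVectors (suc k) = trans
  (length-++ (map (true ∷_) (binaryVectors k)))
  (cong₂ _+_ (half true) (trans (half false) (sym (+-identityʳ (2 ^ k)))))
  where
  half : ∀ b → length (map (b Vec.∷_) (binaryVectors k)) ≡ 2 ^ k
  half b = trans (length-map (b Vec.∷_) (binaryVectors k)) (length-binaryVectors k)

-- The candidate gapsets.

∈-initial⁺ : ∀ {a x} → 1 ≤ x → x ≤ a → x ∈ applyUpTo suc a
∈-initial⁺ {x = suc _} _ x<a = ∈-applyUpTo⁺ suc x<a

∈-initial⁻ : ∀ {a x} → x ∈ applyUpTo suc a → 1 ≤ x × x ≤ a
∈-initial⁻ x∈ with _ , i<a , refl ← ∈-applyUpTo⁻ suc x∈ = s≤s z≤n , i<a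

last-initial : ∀ a → last (applyUpTo suc (suc a)) ≡ just (suc a)
last-initial a = trans (cong last (sym (applyUpTo-∷ʳ suc a))) (last-∷ʳ (applyUpTo suc a))

-- This is `2g − 2` for `g = a + n + 2`, and also the sum of each pair in a transversal of `n`
-- choices starting at `suc a`.
frobenius : ℕ → ℕ → ℕ
frobenius a n = 2 * (suc a + n)

frobenius+2 : ∀ a n → 2 * (suc a + n) + 2 ≡ 2 * (a + n + 2)
frobenius+2 = solve-∀

symmetricSet : ∀ {n} → ℕ → Vec Bool n → List ℕ
symmetricSet {n} a v = applyUpTo suc a ++ transversal (suc a) v ∷ʳ frobenius a n

module _ {n} (a : ℕ) (v : Vec Bool n) where

  private
    T = transversal (suc a) v
    F = frobenius a n

  -- With `κ = suc a`, the largest number available to the transversal is exactly `F − κ`, the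
  -- partner of `κ`.
  upper+κ : suc a + 2 * n + suc a ≡ F
  upper+κ = trans (+-comm _ (suc a)) (lower+upper (suc a) n)

  upper<F : suc a + 2 * n < F
  upper<F = subst (suc a + 2 * n <_) upper+κ (m<m+n _ z<s)

  data Case (x : ℕ) : Set where
    initial  : 1 ≤ x → x ≤ a → Case x
    middle   : x ∈ T → suc a ≤ x → x ≤ suc a + 2 * n → Case x
    terminal : x ≡ F → Case x

  case : ∀ {x} → x ∈ symmetricSet a v → Case x
  case x∈ with ∈-++⁻ (applyUpTo suc a) x∈
  ... | inj₁ x∈I with 1≤x , x≤a ← ∈-initial⁻ x∈I = initial 1≤x x≤a
  ... | inj₂ x∈TF with ∈-++⁻ T x∈TF
  ...   | inj₁ x∈T with l , u ← All.lookup (transversal-bounds (suc a) v) x∈T = middle x∈T l u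
  ...   | inj₂ (here eq) = terminal eq

  symmetricSet-ascending : Ascending (symmetricSet a v)
  symmetricSet-ascending = AllPairs.++⁺
    (AllPairs.applyUpTo⁺₁ suc a (λ i<j _ → s≤s i<j))
    (ascending-∷ʳ (transversal-ascending (suc a) v)
      (All.map (λ (_ , u) → ≤-<-trans u upper<F) bounds))
    (All.tabulate λ x∈I → let x≤a = proj₂ (∈-initial⁻ x∈I) in
      All.∷ʳ⁺ (All.map (λ (l , _) → ≤-<-trans x≤a l) bounds)
              (≤-<-trans x≤a (<-≤-trans (m≤m+n (suc a) _) (<⇒≤ upper<F))))
    where bounds = transversal-bounds (suc a) v

  length-symmetricSet : length (symmetricSet a v) ≡ a + n + 2
  length-symmetricSet
    rewrite length-++ (applyUpTo suc a) {T ∷ʳ F} | length-applyUpTo suc a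
          | length-∷ʳ T {F} | length-transversal (suc a) v = arith a n
    where
    arith : ∀ a n → a + suc (suc n) ≡ a + n + 2
    arith = solve-∀

  symmetricSet-isFrobenius : IsFrobenius (symmetricSet a v) F
  symmetricSet-isFrobenius =
    trans (cong last (sym (++-assoc (applyUpTo suc a) T (F ∷ [])))) (last-∷ʳ (applyUpTo suc a ++ T))

  symmetricSet-pseudoSymmetric : PseudoSymmetric (symmetricSet a v)
  symmetricSet-pseudoSymmetric =
    F , symmetricSet-isFrobenius , trans (frobenius+2 a n) (cong (2 *_) (sym length-symmetricSet))

  symmetricSet-isGapset : 2 * n ≤ a → IsGapset (symmetricSet a v)
  symmetricSet-isGapset 2n≤a = record
    { isFiniteSet⁺ = record
      { positive   = All.tabulate (positive ∘ case)
      ; increasing = Linked.AllPairs⇒Linked symmetricSet-ascending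
      }
    ; split = split
    }
    where
    positive : ∀ {x} → Case x → 1 ≤ x
    positive (initial 1≤x _) = 1≤x
    positive (middle _ l _)  = ≤-trans (s≤s z≤n) l
    positive (terminal refl) = s≤s z≤n
    split : ∀ {z} x y → 1 ≤ x → 1 ≤ y → z ∈ symmetricSet a v → z ≡ x + y →
            x ∈ symmetricSet a v ⊎ y ∈ symmetricSet a v
    split x y 1≤x 1≤y z∈ refl with x ≤? a | y ≤? a
    ... | yes x≤a | _       = inj₁ (∈-++⁺ˡ (∈-initial⁺ 1≤x x≤a))
    ... | no _    | yes y≤a = inj₂ (∈-++⁺ˡ (∈-initial⁺ 1≤y y≤a))
    ... | no x≰a  | no y≰a with case z∈
    ...   | initial _ z≤a  = contradiction (m+n≤o⇒m≤o x z≤a) x≰a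
    -- Here `2 * n ≤ a` enters: both summands are at least `a + 1`, so `z ≥ 2a + 2`, which exceeds
    -- the upper bound `a + 1 + 2n` of the transversal.
    ...   | middle _ _ z≤u = contradiction (≤-<-trans z≤u (<-≤-trans
              (+-monoʳ-< (suc a) (s≤s 2n≤a)) (+-mono-≤ (≰⇒> x≰a) (≰⇒> y≰a)))) (<-irrefl refl)
    ...   | terminal eq    = Sum.map in-T in-T (transversal-meets (suc a) v (≰⇒> x≰a) (≰⇒> y≰a) eq)
      where
      in-T : ∀ {x} → x ∈ T → x ∈ symmetricSet a v
      in-T = ∈-++⁺ʳ (applyUpTo suc a) ∘ ∈-++⁺ˡ

symmetricSet-injective : ∀ {n} a {v w : Vec Bool n} → symmetricSet a v ≡ symmetricSet a w → v ≡ w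
symmetricSet-injective a eq =
  transversal-injective (suc a) (∷ʳ-injectiveˡ _ _ (++-cancelˡ (applyUpTo suc a) _ _ eq))

-- The leading `false` puts `h = F − κ` just before `F`, which gives the difference `κ`. No other
-- difference is larger, because `2n ≤ a` gives `h ≤ a + κ`: the entries from `a` to `h` are all
-- within `κ` of each other.
symmetricSet-pureSparse : ∀ {k} a (w : Vec Bool k) → 2 * suc k ≤ a →
                          PureSparse (suc a) (symmetricSet a (false ∷ w))
-- The hypothesis rules out `a = 0`, so the initial segment is nonempty and ends in `a`.
symmetricSet-pureSparse {k} a@(suc b) w 2n≤a =
  Linked⇒differences-≤
    (Linked.++⁺ initial-linked initial-middle
      (Linked.++⁺ (Linked.AllPairs⇒Linked middle-pairs) middle-terminal [-])) ,
  subst₂ (λ d l → d ∈ differences l) F∸h≡κ (sym reassociate)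
    (∈-differences⁺ (applyUpTo suc a ++ transversal (suc (suc a)) w))
  where
  n = suc k
  h = suc a + 2 * n
  F = frobenius a n
  T = transversal (suc a) (false ∷ w)

  Step : ℕ → ℕ → Set
  Step x y = y ≤ x + suc a

  bounds : All (λ x → suc a ≤ x × x ≤ h) T
  bounds = transversal-bounds (suc a) (false ∷ w)

  h+κ≡F : h + suc a ≡ F
  h+κ≡F = upper+κ a (false ∷ w)

  F∸h≡κ : F ∸ h ≡ suc a
  F∸h≡κ = trans (cong (_∸ h) (sym h+κ≡F)) (m+n∸m≡n h (suc a))

  h≤a+κ : h ≤ a + suc a
  h≤a+κ = subst (h ≤_) (sym (+-suc a a)) (+-monoʳ-≤ (suc a) 2n≤a)

  initial-linked : Linked Step (applyUpTo suc a)
  initial-linked = Linked.applyUpTo⁺₂ suc a (λ i → s≤s (m≤m+n-suc i))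
    where
    m≤m+n-suc : ∀ i → suc i ≤ i + suc a
    m≤m+n-suc i = subst (suc i ≤_) (sym (+-suc i a)) (s≤s (m≤m+n i a))

  head-connected : ∀ {x} ys {zs} → 0 < length ys → All (Step x) ys →
                   Connected Step (just x) (head (ys ++ zs))
  head-connected (_ ∷ _) _ (p ∷ _) = just p

  middle-terminal : Connected Step (last T) (just F)
  middle-terminal rewrite last-∷ʳ (transversal (suc (suc a)) w) {h} = just (≤-reflexive (sym h+κ≡F))

  initial-middle : Connected Step (last (applyUpTo suc a)) (head (T ∷ʳ F))
  initial-middle rewrite last-initial b =
    -- The first entry of `T` depends on `w`, so the bound is supplied for every entry.
    head-connected T (subst (0 <_) (sym (length-transversal (suc a) (false ∷ w))) z<s)
      (All.map (λ (_ , u) → ≤-trans u h≤a+κ) bounds)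

  middle-pairs : AllPairs Step T
  middle-pairs = all-pairs bounds
    where
    all-pairs : ∀ {xs} → All (λ x → suc a ≤ x × x ≤ h) xs → AllPairs Step xs
    all-pairs []             = []
    all-pairs ((l , _) ∷ bs) =
      All.map (λ (_ , u) → ≤-trans u (≤-trans h≤a+κ (+-monoˡ-≤ (suc a) (≤-trans (n≤1+n a) l)))) bs
      ∷ all-pairs bs

  reassociate : symmetricSet a (false ∷ w) ≡
                (applyUpTo suc a ++ transversal (suc (suc a)) w) ++ h ∷ F ∷ []
  reassociate = trans
    (cong (applyUpTo suc a ++_) (++-assoc (transversal (suc (suc a)) w) (h ∷ []) (F ∷ [])))
    (sym (++-assoc (applyUpTo suc a) _ _))

-- Every pseudo-symmetric gapset of the given kind is a candidate.

gapset-ascending : ∀ {G} → IsGapset G → Ascending G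
gapset-ascending = Linked.Linked⇒AllPairs <-trans ∘ IsFiniteSet⁺.increasing ∘ IsGapset.isFiniteSet⁺

initial⊆gapset : ∀ {κ G} → IsGapset G → PureSparse κ G → ∀ {i} → 1 ≤ i → i < κ → i ∈ G
initial⊆gapset {κ} {G} gapset (_ , κ∈) {i} 1≤i i<κ with i ∈? G
... | yes i∈G = i∈G
... | no i∉G
  with a , b , b∈G , _ , refl , consecutive ← ∈-differences⁻ (gapset-ascending gapset) κ∈
  -- Since `i < b`, the subtraction `b ∸ i` is exact and `b = i + (b ∸ i)` is a decomposition to
  -- split.
  with i<b ← <-≤-trans i<κ (m∸n≤m b a)
  with IsGapset.split gapset i (b ∸ i) 1≤i (m<n⇒0<n∸m i<b) b∈G (sym (m+[n∸m]≡n (<⇒≤ i<b)))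
... | inj₁ i∈G = contradiction i∈G i∉G
... | inj₂ b∸i∈G with consecutive b∸i∈G
-- `b − i ≤ a` would give `κ = b − a ≤ i`, and `b ≤ b − i` fails as `i ≥ 1`; so `b − i` lies
-- strictly inside the jump.
...   | inj₁ b∸i≤a = contradiction i<κ (≤⇒≯ (m≤n+o⇒m∸n≤o b a
          (≤-trans (m≤n+m∸n b i) (≤-trans (+-monoʳ-≤ i b∸i≤a) (≤-reflexive (+-comm i a))))))
...   | inj₂ b≤b∸i = contradiction b≤b∸i (<⇒≱ (∸-monoʳ-< 1≤i (<⇒≤ i<b)))

pseudoSymmetric⇒symmetricSet : ∀ {a k G} → 𝒢 (suc a) (a + suc k + 2) G → PseudoSymmetric G →
                               ∃[ w ] G ≡ symmetricSet a (false ∷ w)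
pseudoSymmetric⇒symmetricSet {a} {k} {G}
  record { isGapset = gapset ; pureSparse = sparse ; hasGenus = genus≡ }
  (F′ , F′-last , F′+2≡2g)
  with refl ← +-cancelʳ-≡ 2 F′ (frobenius a (suc k))
         (trans F′+2≡2g (trans (cong (2 *_) genus≡) (sym (frobenius+2 a (suc k)))))
  = go (∃transversal (suc a) n λ x y a<x a<y eq →
         IsGapset.split gapset x y (≤-trans z<s a<x) (≤-trans z<s a<y) F∈G (sym eq))
  where
  n = suc k
  F = frobenius a n

  F∈G : F ∈ G
  F∈G = last-∈ G F′-last

  G↗ : Ascending G
  G↗ = gapset-ascending gapset

  go : ∃[ v ] All (_∈ G) (transversal {n} (suc a) v) → ∃[ w ] G ≡ symmetricSet a (false ∷ w)
  go (v , v⊆G) = decide v G≡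
    where
    G≡ : G ≡ symmetricSet a v
    -- The candidate is contained in `G` and both have `g` elements.
    G≡ = sym (⊆∧length-≥⇒≡ (symmetricSet-ascending a v) G↗ (⊆G ∘ case a v)
               (≤-reflexive (trans genus≡ (sym (length-symmetricSet a v)))))
      where
      ⊆G : ∀ {x} → Case a v x → x ∈ G
      ⊆G (initial 1≤x x≤a) = initial⊆gapset gapset sparse 1≤x (s≤s x≤a)
      ⊆G (middle x∈T _ _)  = All.lookup v⊆G x∈T
      ⊆G (terminal refl)   = F∈G

    decide : ∀ v → G ≡ symmetricSet a v → ∃[ w ] G ≡ symmetricSet a (false ∷ w)
    decide (false ∷ w) eq = w , eq
    -- Choosing `κ` over `h = F − κ` leaves every element below `F` smaller than `h`, so the jump to
    -- `F` would exceed `κ`.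
    decide (true ∷ w)  eq
      with p , p∈G , p<F , F≤p+κ ← penultimate G↗ (proj₁ sparse) F′-last
             (≤-trans (m≤n+m 2 (a + n)) (≤-reflexive (sym genus≡)))
      = contradiction h≤p (<⇒≱ (p<h (case a (true ∷ w) (subst (p ∈_) eq p∈G))))
      where
      h≤p : suc a + 2 * n ≤ p
      h≤p = +-cancelʳ-≤ (suc a) _ _ (≤-trans (≤-reflexive (upper+κ a v)) F≤p+κ)
      p<h : Case a (true ∷ w) p → p < suc a + 2 * n
      p<h (initial _ p≤a)          = ≤-trans (s≤s p≤a) (m≤m+n (suc a) _)
      p<h (middle (here refl) _ _) = m<m+n (suc a) z<s
      p<h (middle (there p∈T) _ _) =
        ≤-trans (s≤s (proj₂ (All.lookup (transversal-bounds (suc (suc a)) w) p∈T)))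
                (≤-reflexive (upper-suc (suc a) k))
      p<h (terminal refl)          = contradiction p<F (<-irrefl refl)

-- The count.

-- Of the `suc k` choices the first is forced to be `false`, and the remaining `k` are free.
pseudoSymmetric-count : ∀ a k → 2 * suc k ≤ a →
  HasCount (λ G → 𝒢 (suc a) (a + suc k + 2) G × PseudoSymmetric G) (2 ^ k)
pseudoSymmetric-count a k 2n≤a =
  map family (binaryVectors k) ,
  Unique.map⁺ family-injective (binaryVectors-unique k) ,
  (λ G → mk⇔ sound complete) ,
  trans (length-map family (binaryVectors k)) (length-binaryVectors k)
  where
  family : Vec Bool k → List ℕ
  family w = symmetricSet a (false ∷ w)

  family-injective : ∀ {v w} → family v ≡ family w → v ≡ w
  family-injective {v} {w} eq
    with refl ← symmetricSet-injective a {false ∷ v} {false ∷ w} eq = refl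

  sound : ∀ {G} → G ∈ map family (binaryVectors k) → 𝒢 (suc a) (a + suc k + 2) G × PseudoSymmetric G
  sound G∈ with w , _ , refl ← ∈-map⁻ family G∈ = record
    { isGapset   = symmetricSet-isGapset a (false ∷ w) 2n≤a
    ; pureSparse = symmetricSet-pureSparse a w 2n≤a
    ; hasGenus   = length-symmetricSet a (false ∷ w)
    } , symmetricSet-pseudoSymmetric a (false ∷ w)

  complete : ∀ {G} → 𝒢 (suc a) (a + suc k + 2) G × PseudoSymmetric G → G ∈ map family (binaryVectors k)
  complete (G∈𝒢 , ps) with w , refl ← pseudoSymmetric⇒symmetricSet G∈𝒢 ps = ∈-map⁺ family (∈-binaryVectors w)

mainTheorem5 : (n : ℕ) .{{_ : NonZero n}} →
    HasCount (λ G → 𝒢 (2 * n + 1) (3 * n + 2) G × PseudoSymmetric G) (2 ^ (n ∸ 1))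
mainTheorem5 (suc k) =
  -- The case `a = 2n`, the smallest value allowed: `κ = 2n + 1` and `g = 2n + n + 2`.
  subst₂ (λ κ g → HasCount (λ G → 𝒢 κ g G × PseudoSymmetric G) (2 ^ k))
    (κ≡ (suc k)) (g≡ (suc k)) (pseudoSymmetric-count (2 * suc k) k ≤-refl)
  where
  κ≡ : ∀ n → suc (2 * n) ≡ 2 * n + 1
  κ≡ = solve-∀
  g≡ : ∀ n → 2 * n + n + 2 ≡ 3 * n + 2
  g≡ = solve-∀
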